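{- Let $\mathcal{L}_{\rm TM}$ be the Thue–Morse language and let ${\rm S}:\mathcal{L}_{\rm TM}\to\mathbb{N}$ be a homomorphism with $\gcd({\rm S}(a),{\rm S}(b))=1$. Then $\mathbb{N}\setminus{\rm S}(\mathcal{L}_{\rm TM})$ is infinite if and only if ${\rm S}(a)+{\rm S}(b)\ge6$. If ${\rm S}(a)+{\rm S}(b)<6$, then $\mathbb{N}\setminus{\rm S}(\mathcal{L}_{\rm TM})$ is either empty or a singleton.
   Context: $\mathbb{N}=\{1,2,3,\dots\}$. Let $\theta$ be the Thue–Morse morphism on $\{a,b\}$, $\theta(a)=ab$, $\theta(b)=ba$. The Thue–Morse language $\mathcal{L}_{\rm TM}$ is the set of all nonempty finite words occurring as factors of $\theta^n(a)$ for some $n\ge0$. A homomorphism ${\rm S}:\mathcal{L}_{\rm TM}\to\mathbb{N}$ is a map with ${\rm S}(w_1\cdots w_n)={\rm S}(w_1)+\cdots+{\rm S}(w_n)$, determined by ${\rm S}(a),{\rm S}(b)\in\mathbb{N}$. -}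

module Defs where

open import Data.List.Base using (List; []; _∷_; map; sum; concatMap)
open import Data.List.Membership.Propositional using () renaming (_∉_ to _∉ˡ_)
open import Data.List.Relation.Binary.Infix.Heterogeneous using (Infix; here; there)
open import Data.List.Relation.Binary.Prefix.Heterogeneous using ([]; _∷_)
open import Data.Nat.Base using (ℕ; _<_)
open import Data.Nat.GeneralisedArithmetic using (fold)
open import Data.Product.Base using (∃; _×_; _,_; proj₁)
open import Level using (0ℓ)
open import Relation.Binary.PropositionalEquality.Core using (_≡_; _≢_; refl)
open import Relation.Unary using (Pred; _∈_)

data Letter : Set where
  a b : Letter

Word : Set
Word = List Letter

θ-letter : Letter → Word
θ-letter a = a ∷ b ∷ []
θ-letter b = b ∷ a ∷ []

θ : Word → Word
θ = concatMap θ-letter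

θ^_⟨a⟩ : ℕ → Word
θ^ n ⟨a⟩ = fold (a ∷ []) θ n

Factor : Word → Word → Set
Factor = Infix _≡_

TM : Pred Word 0ℓ
TM w = w ≢ [] × ∃ λ n → Factor w (θ^ n ⟨a⟩)

𝓛TM : Set
𝓛TM = ∃ TM

letter : Letter → 𝓛TM
letter a = a ∷ [] , (λ ()) , 0 , here (refl ∷ [])
letter b = b ∷ [] , (λ ()) , 1 , there (here (refl ∷ []))

ℕ⁺ : Pred ℕ 0ℓ
ℕ⁺ n = 0 < n

-- The defining equation makes the value depend only on the underlying word,
-- not on the proof that it belongs to the language.
record Homomorphism : Set where
  field
    S        : 𝓛TM → ℕ
    positive : ∀ w → S w ∈ ℕ⁺
    additive : ∀ w → S w ≡ sum (map (λ x → S (letter x)) (proj₁ w))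

Image : {A : Set} → (A → ℕ) → Pred ℕ 0ℓ
Image f n = ∃ λ x → f x ≡ n

-- No finite list exhausts P, with an element outside the list as witness; this
-- is constructively stronger than the negation of finiteness.
Infinite : Pred ℕ 0ℓ → Set
Infinite P = (xs : List ℕ) → ∃ λ n → n ∈ P × n ∉ˡ xs

{-# OPTIONS --safe #-}
-- Write p = S(a), q = S(b) and s = p + q. Cutting a factor of θ(v) along the
-- blocks ab, ba leaves at most one loose letter at each end, so S takes only
-- values of the form i p + j q + k s with i + j ≤ 2. All positive such values
-- occur: for any letters x, y and any k there is w of length k such that x w y
-- is in the language, and if x̄ w y is in the language then so is x θ(w) y.
-- As q ≡ - p, the values lie in the classes 0, ± p, ± 2p modulo s. For s ≥ 6 and
-- p coprime to s the class of 3p is none of these, hence is missed entirely.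
-- The five coprime pairs p ≤ q with s < 6 are settled by inspection.
module Submission where

open import Defs
open import Data.List.Base using ([]; _∷_; _++_; [_]; map; length)
open import Data.List.Extrema.Nat using (max; xs≤max)
open import Data.List.Properties using (++-assoc; map-++; concatMap-++)
open import Data.List.Relation.Binary.Infix.Heterogeneous using (here; there; MkView; fromView; toView)
import Data.List.Relation.Binary.Infix.Heterogeneous.Properties as Infix
open import Data.List.Relation.Binary.Pointwise using (Pointwise-≡⇒≡; ≡⇒Pointwise-≡)
open import Data.List.Relation.Binary.Prefix.Heterogeneous using (Prefix; []; _∷_)
open import Data.List.Relation.Unary.All using (lookup)
open import Data.List.Relation.Unary.Any using (here)
open import Data.Nat.Base using (ℕ; zero; suc; _+_; _*_; _≤_; _<_; _≥_; z≤n; s≤s; z<s; NonZero; ⌊_/2⌋)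
open import Data.Nat.Coprimality using (Coprime; gcd≡1⇒coprime; coprime-+; coprime-divisor)
import Data.Nat.Coprimality as Coprimality
open import Data.Nat.Divisibility using (_∣_; divides; divides-refl; ∣m+n∣m⇒∣n; ∣⇒≤)
open import Data.Nat.GCD using (gcd; gcd-comm)
open import Data.Nat.Induction using (<-rec)
open import Data.Nat.ListAction using (sum)
open import Data.Nat.ListAction.Properties using (sum-++)
open import Data.Nat.Properties
open import Data.Nat.Tactic.RingSolver using (solve-∀)
open import Data.Product.Base using (∃; _×_; _,_; proj₁; proj₂)
open import Data.Sum.Base using (_⊎_; inj₁; inj₂)
open import Function.Base using (_∘_)
open import Function.Bundles using (_⇔_; mk⇔)
open import Level using (0ℓ)
open import Relation.Binary.PropositionalEquality using (_≡_; _≢_; refl; sym; trans; cong; cong₂; subst; module ≡-Reasoning)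
open import Relation.Nullary using (¬_; contradiction; yes; no; decidable-stable)
open import Relation.Unary using (Pred; _∖_; _∩_; _≐_; ∅; ｛_｝)
open import Relation.Unary.Properties using (≐-trans)

-- Factors of the Thue–Morse word

bar : Letter → Letter
bar a = b
bar b = a

Factor-refl-++ : ∀ u w v → Factor w (u ++ w ++ v)
Factor-refl-++ u w v = fromView (MkView u (≡⇒Pointwise-≡ refl) v)

θ-Factor : ∀ {w v} → Factor w v → Factor (θ w) (θ v)
θ-Factor {w} f with MkView u w≡ v ← toView f with refl ← Pointwise-≡⇒≡ w≡ =
  subst (Factor (θ w)) (sym eq) (Factor-refl-++ (θ u) (θ w) (θ v))
  where
  eq : θ (u ++ w ++ v) ≡ θ u ++ θ w ++ θ v
  eq = trans (concatMap-++ θ-letter u (w ++ v)) (cong (θ u ++_) (concatMap-++ θ-letter w v))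

TM-Factor-θ : ∀ {w v} → w ≢ [] → Factor w (θ v) → TM v → TM w
TM-Factor-θ w≢[] f (_ , n , g) = w≢[] , suc n , Infix.trans trans f (θ-Factor g)

TM-tail : ∀ {x w} → w ≢ [] → TM (x ∷ w) → TM w
TM-tail w≢[] (_ , n , f) = w≢[] , n , Infix.trans trans (there (Infix.fromPointwise (≡⇒Pointwise-≡ refl))) f

++[]-nonempty : ∀ (w : Word) {y} → w ++ [ y ] ≢ []
++[]-nonempty []      ()
++[]-nonempty (_ ∷ _) ()

-- All four pairs occur in `abbabaab`, the third iterate. Each exponent is the first at which the
-- pair appears.
TM-pair : ∀ x y → TM (x ∷ y ∷ [])
TM-pair a a = (λ ()) , 3 , Factor-refl-++ (a ∷ b ∷ b ∷ a ∷ b ∷ []) _ (b ∷ [])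
TM-pair a b = (λ ()) , 1 , Factor-refl-++ [] _ []
TM-pair b a = (λ ()) , 2 , Factor-refl-++ (a ∷ b ∷ []) _ []
TM-pair b b = (λ ()) , 2 , Factor-refl-++ (a ∷ []) _ (a ∷ [])

-- The bracketing sets the last letter apart, so that the rest is visibly a prefix of the image.
θ-flanked : ∀ x w y → θ (x ∷ w ++ [ y ]) ≡ (x ∷ bar x ∷ θ w ++ [ y ]) ++ [ bar y ]
θ-flanked x w y = trans (θ-∷ x (w ++ [ y ])) (cong (λ v → x ∷ bar x ∷ v) eq)
  where
  θ-∷ : ∀ x w → θ (x ∷ w) ≡ x ∷ bar x ∷ θ w
  θ-∷ a w = refl
  θ-∷ b w = refl

  eq : θ (w ++ [ y ]) ≡ (θ w ++ [ y ]) ++ [ bar y ]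
  eq = trans (concatMap-++ θ-letter w [ y ])
         (trans (cong (θ w ++_) (θ-∷ y [])) (sym (++-assoc (θ w) [ y ] [ bar y ])))

-- Dropping only the last letter of `θ (x ∷ w ++ [ y ])` turns a gap of length d between the end
-- letters into one of length 2d + 1.
TM-double : ∀ {x w y} → TM (x ∷ w ++ [ y ]) → TM (x ∷ bar x ∷ θ w ++ [ y ])
TM-double {x} {w} {y} t = TM-Factor-θ (λ ())
  (subst (Factor _) (sym (θ-flanked x w y)) (Factor-refl-++ [] _ [ bar y ])) t

-- Dropping the first letter as well gives a gap of length 2d. The block of `bar x` ends in `x`,
-- which is why the flanking letter flips.
TM-double′ : ∀ x {w y} → TM (bar x ∷ w ++ [ y ]) → TM (x ∷ θ w ++ [ y ])
-- The split on the letter lets `bar (bar x)` compute to `x`.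
TM-double′ a = TM-tail (λ ()) ∘ TM-double
TM-double′ b = TM-tail (λ ()) ∘ TM-double

length-θ : ∀ w → length (θ w) ≡ length w * 2
length-θ []      = refl
length-θ (a ∷ w) = cong (suc ∘ suc) (length-θ w)
length-θ (b ∷ w) = cong (suc ∘ suc) (length-θ w)

Joined : ℕ → Set
Joined d = ∀ x y → ∃ λ w → length w ≡ d × TM (x ∷ w ++ [ y ])

halve : ∀ d → d ≡ ⌊ d /2⌋ * 2 ⊎ d ≡ suc (⌊ d /2⌋ * 2)
halve 0 = inj₁ refl
halve 1 = inj₂ refl
halve (suc (suc d)) with halve d
... | inj₁ eq = inj₁ (cong (suc ∘ suc) eq)
... | inj₂ eq = inj₂ (cong (suc ∘ suc) eq)

-- Strong induction by halving the gap. Both end letters are quantified inside `Joined` because the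
-- even case calls the hypothesis at `bar x`.
joined : ∀ d → Joined d
joined = <-rec Joined step
  where
  step : ∀ d → (∀ {e} → e < d → Joined e) → Joined d
  step zero    rec x y = [] , refl , TM-pair x y
  step (suc d) rec x y with halve (suc d)
  ... | inj₁ even with w , ∣w∣ , t ← rec (⌊n/2⌋<n d) (bar x) y =
    θ w , trans (length-θ w) (trans (cong (_* 2) ∣w∣) (sym even)) , TM-double′ x t
  ... | inj₂ odd with w , ∣w∣ , t ← rec (⌊n/2⌋<n d) x y =
    bar x ∷ θ w , trans (cong suc (trans (length-θ w) (cong (_* 2) ∣w∣))) (sym odd) , TM-double t

-- Values of homomorphisms

-- With p = S(a), q = S(b): k full blocks and at most c loose letters.
Blocks : ℕ → ℕ → ℕ → Pred ℕ 0ℓ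
Blocks c p q n = ∃ λ i → ∃ λ j → ∃ λ k → i + j ≤ c × n ≡ i * p + j * q + k * (p + q)

Blocks-zero : ∀ {c p q} → Blocks c p q 0
Blocks-zero = 0 , 0 , 0 , z≤n , refl

Blocks-weaken : ∀ {c p q n} → Blocks c p q n → Blocks (suc c) p q n
Blocks-weaken (i , j , k , i+j≤c , eq) = i , j , k , m≤n⇒m≤1+n i+j≤c , eq

Blocks-swap : ∀ {c p q n} → Blocks c p q n → Blocks c q p n
Blocks-swap {c} {p} {q} (i , j , k , i+j≤c , eq) =
  j , i , k , subst (_≤ c) (+-comm i j) i+j≤c
  , trans eq (cong₂ _+_ (+-comm (i * p) (j * q)) (cong (k *_) (+-comm p q)))

Blocks-+p : ∀ {c p q n} → Blocks c p q n → Blocks (suc c) p q (p + n)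
Blocks-+p {p = p} {q} (i , j , k , i+j≤c , refl) = suc i , j , k , s≤s i+j≤c , lemma i j k p q
  where
  lemma : ∀ i j k p q → p + (i * p + j * q + k * (p + q)) ≡ suc i * p + j * q + k * (p + q)
  lemma = solve-∀

Blocks-+q : ∀ {c p q n} → Blocks c p q n → Blocks (suc c) p q (q + n)
Blocks-+q = Blocks-swap ∘ Blocks-+p ∘ Blocks-swap

Blocks-+pq : ∀ {c p q n} → Blocks c p q n → Blocks c p q (p + (q + n))
Blocks-+pq {p = p} {q} (i , j , k , i+j≤c , refl) = i , j , suc k , i+j≤c , lemma i j k p q
  where
  lemma : ∀ i j k p q → p + (q + (i * p + j * q + k * (p + q))) ≡ i * p + j * q + suc k * (p + q)
  lemma = solve-∀

Blocks-+qp : ∀ {c p q n} → Blocks c p q n → Blocks c p q (q + (p + n))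
Blocks-+qp = Blocks-swap ∘ Blocks-+pq ∘ Blocks-swap

module Weight (σ : Letter → ℕ) where

  private
    s : ℕ
    s = σ a + σ b

  weight : Word → ℕ
  weight w = sum (map σ w)

  weight-++ : ∀ v w → weight (v ++ w) ≡ weight v + weight w
  weight-++ v w = trans (cong sum (map-++ σ v w)) (sum-++ (map σ v) (map σ w))

  -- Both blocks `ab` and `ba` weigh `s`, so only the number of blocks counts.
  weight-θ : ∀ w → weight (θ w) ≡ length w * s
  weight-θ []      = refl
  weight-θ (a ∷ w) = trans (sym (+-assoc (σ a) (σ b) _)) (cong (s +_) (weight-θ w))
  weight-θ (b ∷ w) = trans (sym (+-assoc (σ b) (σ a) _)) (cong₂ _+_ (+-comm (σ b) (σ a)) (weight-θ w))

  weight-θ-∷ʳ : ∀ w y → weight (θ w ++ [ y ]) ≡ length w * s + σ y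
  weight-θ-∷ʳ w y = trans (weight-++ (θ w) [ y ]) (cong₂ _+_ (weight-θ w) (+-identityʳ (σ y)))

  -- A prefix takes whole blocks and then at most the first half of one more, which is the only
  -- loose letter.
  prefix-θ : ∀ v {w} → Prefix _≡_ w (θ v) → Blocks 1 (σ a) (σ b) (weight w)
  prefix-θ []      []                = Blocks-zero
  prefix-θ (a ∷ v) []                = Blocks-zero
  prefix-θ (a ∷ v) (refl ∷ [])       = Blocks-+p Blocks-zero
  prefix-θ (a ∷ v) (refl ∷ refl ∷ p) = Blocks-+pq (prefix-θ v p)
  prefix-θ (b ∷ v) []                = Blocks-zero
  prefix-θ (b ∷ v) (refl ∷ [])       = Blocks-+q Blocks-zero
  prefix-θ (b ∷ v) (refl ∷ refl ∷ p) = Blocks-+qp (prefix-θ v p)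

  -- Blocks in front of the factor are skipped. A factor that starts mid-block contributes the
  -- second letter of that block and continues as a prefix, which adds at most one more loose
  -- letter.
  factor-θ : ∀ v {w} → Factor w (θ v) → Blocks 2 (σ a) (σ b) (weight w)
  factor-θ []      (here p)                   = Blocks-weaken (prefix-θ [] p)
  factor-θ (a ∷ v) (here p)                   = Blocks-weaken (prefix-θ (a ∷ v) p)
  factor-θ (a ∷ v) (there (here []))          = Blocks-zero
  factor-θ (a ∷ v) (there (here (refl ∷ p)))  = Blocks-+q (prefix-θ v p)
  factor-θ (a ∷ v) (there (there f))          = factor-θ v f
  factor-θ (b ∷ v) (here p)                   = Blocks-weaken (prefix-θ (b ∷ v) p)
  factor-θ (b ∷ v) (there (here []))          = Blocks-zero
  factor-θ (b ∷ v) (there (here (refl ∷ p)))  = Blocks-+p (prefix-θ v p)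
  factor-θ (b ∷ v) (there (there f))          = factor-θ v f

  TM⇒Blocks : ∀ {w} → TM w → Blocks 2 (σ a) (σ b) (weight w)
  -- The zeroth iterate is the bare letter `a`, to which the cutting into blocks does not apply.
  TM⇒Blocks (_ , zero  , here [])          = Blocks-zero
  TM⇒Blocks (_ , zero  , here (refl ∷ [])) = Blocks-+p Blocks-zero
  TM⇒Blocks (_ , zero  , there (here []))  = Blocks-zero
  TM⇒Blocks (_ , suc n , f)                = factor-θ (θ^ n ⟨a⟩) f

  TMWeight : Pred ℕ 0ℓ
  TMWeight n = ∃ λ w → TM w × weight w ≡ n

  one-loose : ∀ y k → TMWeight (k * s + σ y)
  -- The left neighbour only serves to invoke `TM-double′` and is then cut off; `a` is `bar b`.
  one-loose y k with w , refl , t ← joined k a y =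
    θ w ++ [ y ] , TM-tail (++[]-nonempty (θ w)) (TM-double′ b t) , weight-θ-∷ʳ w y

  two-loose : ∀ x y k → TMWeight (σ x + (k * s + σ y))
  two-loose x y k with w , refl , t ← joined k (bar x) y =
    x ∷ θ w ++ [ y ] , TM-double′ x t , cong (σ x +_) (weight-θ-∷ʳ w y)

  Blocks⇒TMWeight : ∀ {n} → 0 < n → Blocks 2 (σ a) (σ b) n → TMWeight n
  Blocks⇒TMWeight n>0 (i , j , k , i+j≤2 , refl) = go i j k i+j≤2 n>0
    where
    go : ∀ i j k → i + j ≤ 2 → 0 < i * σ a + j * σ b + k * s → TMWeight (i * σ a + j * σ b + k * s)
    -- Positivity forces a block here. One of the k + 1 blocks is split into a leading `a` and a
    -- trailing `b`, with k blocks between them.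
    go 0 0 (suc k) _ _ = subst TMWeight (eq (σ a) (σ b) k) (two-loose a b k)
      where
      eq : ∀ p q k → p + (k * (p + q) + q) ≡ suc k * (p + q)
      eq = solve-∀
    go 1 0 k _ _ = subst TMWeight (eq (σ a) (σ b) k) (one-loose a k)
      where
      eq : ∀ p q k → k * (p + q) + p ≡ 1 * p + 0 * q + k * (p + q)
      eq = solve-∀
    go 0 1 k _ _ = subst TMWeight (eq (σ a) (σ b) k) (one-loose b k)
      where
      eq : ∀ p q k → k * (p + q) + q ≡ 0 * p + 1 * q + k * (p + q)
      eq = solve-∀
    go 2 0 k _ _ = subst TMWeight (eq (σ a) (σ b) k) (two-loose a a k)
      where
      eq : ∀ p q k → p + (k * (p + q) + p) ≡ 2 * p + 0 * q + k * (p + q)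
      eq = solve-∀
    go 1 1 k _ _ = subst TMWeight (eq (σ a) (σ b) k) (two-loose a b k)
      where
      eq : ∀ p q k → p + (k * (p + q) + q) ≡ 1 * p + 1 * q + k * (p + q)
      eq = solve-∀
    go 0 2 k _ _ = subst TMWeight (eq (σ a) (σ b) k) (two-loose b b k)
      where
      eq : ∀ p q k → q + (k * (p + q) + q) ≡ 0 * p + 2 * q + k * (p + q)
      eq = solve-∀
    go 0 (suc (suc (suc _))) _ (s≤s (s≤s ())) _
    go 1 (suc (suc _)) _ (s≤s (s≤s ())) _
    go 2 (suc _) _ (s≤s (s≤s ())) _
    go (suc (suc (suc _))) _ _ (s≤s (s≤s ())) _

module _ (h : Homomorphism) where
  open Homomorphism h
  open Weight (S ∘ letter)

  -- The restriction to `ℕ⁺` removes 0, which `Blocks` contains as the weight of the empty word.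
  Image≐Blocks : Image S ≐ ℕ⁺ ∩ Blocks 2 (S (letter a)) (S (letter b))
  Image≐Blocks = to , from
    where
    to : ∀ {n} → Image S n → (ℕ⁺ ∩ Blocks 2 (S (letter a)) (S (letter b))) n
    to (w , refl) = positive w , subst (Blocks 2 _ _) (sym (additive w)) (TM⇒Blocks (proj₂ w))

    from : ∀ {n} → (ℕ⁺ ∩ Blocks 2 (S (letter a)) (S (letter b))) n → Image S n
    from (n>0 , bl) with w , t , refl ← Blocks⇒TMWeight n>0 bl = (w , t) , additive (w , t)

  missed≐ : (ℕ⁺ ∖ Image S) ≐ (ℕ⁺ ∖ Blocks 2 (S (letter a)) (S (letter b)))
  missed≐ = (λ (n>0 , ∉) → n>0 , λ bl → ∉ (proj₂ Image≐Blocks (n>0 , bl)))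
          , (λ (n>0 , ∉) → n>0 , λ im → ∉ (proj₂ (proj₁ Image≐Blocks im)))

-- Large letter sums

3p-missed : ∀ {p q} → Coprime p q → 6 ≤ p + q → ∀ m → ¬ Blocks 2 p q (3 * p + m * (p + q))
3p-missed {p} {q} coprime s≥6 m (i , j , k , i+j≤2 , eq) = absurd i j i+j≤2 eq
  where
  -- As p is coprime to p + q, it cancels, so p + q would divide c, which is nonzero and at most 5.
  s∤ : ∀ c .{{_ : NonZero c}} → c ≤ 5 → ¬ (p + q ∣ p * c)
  s∤ c c≤5 s∣pc = <⇒≱ s≥6 (≤-trans (∣⇒≤ (coprime-divisor
    (coprime-+ (Coprimality.sym coprime)) s∣pc)) c≤5)

  -- i p + j q + k s ≡ 3 p + m s gives (3 - i + j) p ≡ 0 modulo s; here c = 3 - i + j.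
  s∣ : ∀ i j c → c + i ≡ 3 + j → 3 * p + m * (p + q) ≡ i * p + j * q + k * (p + q) → p + q ∣ p * c
  s∣ i j c c+i eq = ∣m+n∣m⇒∣n (divides (k + j) (+-cancelʳ-≡ (i * p) _ _ eq′)) (divides-refl m)
    where
    open ≡-Reasoning
    e₁ : ∀ m p q c i → m * (p + q) + p * c + i * p ≡ (c + i) * p + m * (p + q)
    e₁ = solve-∀
    e₂ : ∀ m p q j → (3 + j) * p + m * (p + q) ≡ 3 * p + m * (p + q) + j * p
    e₂ = solve-∀
    e₃ : ∀ i j k p q → i * p + j * q + k * (p + q) + j * p ≡ (k + j) * (p + q) + i * p
    e₃ = solve-∀
    eq′ : m * (p + q) + p * c + i * p ≡ (k + j) * (p + q) + i * p
    eq′ = begin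
      m * (p + q) + p * c + i * p             ≡⟨ e₁ m p q c i ⟩
      (c + i) * p + m * (p + q)               ≡⟨ cong (λ x → x * p + m * (p + q)) c+i ⟩
      (3 + j) * p + m * (p + q)               ≡⟨ e₂ m p q j ⟩
      -- The added j p completes each loose q to a full block, whence the quotient k + j.
      3 * p + m * (p + q) + j * p             ≡⟨ cong (_+ j * p) eq ⟩
      i * p + j * q + k * (p + q) + j * p     ≡⟨ e₃ i j k p q ⟩
      (k + j) * (p + q) + i * p               ∎

  absurd : ∀ i j → i + j ≤ 2 → ¬ (3 * p + m * (p + q) ≡ i * p + j * q + k * (p + q))
  absurd 0 j j≤2 = s∤ (3 + j) (+-monoʳ-≤ 3 j≤2) ∘ s∣ 0 j (3 + j) (+-identityʳ _)
  absurd 1 j (s≤s j≤1) = s∤ (2 + j) (+-monoʳ-≤ 2 (≤-trans j≤1 (s≤s z≤n))) ∘ s∣ 1 j (2 + j) (+-comm (2 + j) 1)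
  absurd 2 j (s≤s (s≤s j≤0)) = s∤ (1 + j) (+-monoʳ-≤ 1 (≤-trans j≤0 z≤n)) ∘ s∣ 2 j (1 + j) (+-comm (1 + j) 2)
  absurd (suc (suc (suc _))) _ (s≤s (s≤s ()))

missed-infinite : ∀ {p q} → 0 < p → Coprime p q → 6 ≤ p + q → Infinite (ℕ⁺ ∖ Blocks 2 p q)
missed-infinite {p@(suc _)} {q} _ coprime s≥6 xs = n , (z<s , 3p-missed coprime s≥6 m) , λ n∈xs →
  <⇒≱ m<n (lookup (xs≤max 0 xs) n∈xs)
  where
  m n : ℕ
  -- Taking the maximum as the number of blocks pushes `n` above every entry, since p + q is at
  -- least 1 and 3 p is positive.
  m = max 0 xs
  n = 3 * p + m * (p + q)

  m<n : m < n
  m<n = +-mono-≤ {1} {3 * p} z<s (m≤m*n m (p + q))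

-- Small letter sums

AtMostOne : Pred ℕ 0ℓ → Set
AtMostOne P = (P ≐ ∅) ⊎ (∃ λ m → P ≐ ｛ m ｝)

AtMostOne-resp-≐ : ∀ {P Q} → P ≐ Q → AtMostOne Q → AtMostOne P
AtMostOne-resp-≐ P≐Q (inj₁ Q≐∅)       = inj₁ (≐-trans P≐Q Q≐∅)
AtMostOne-resp-≐ P≐Q (inj₂ (m , Q≐m)) = inj₂ (m , ≐-trans P≐Q Q≐m)

-- Testing infinitude on the list of all possible elements, `[]` or `[ m ]`, yields the
-- contradiction.
AtMostOne⇒¬Infinite : ∀ {P} → AtMostOne P → ¬ Infinite P
AtMostOne⇒¬Infinite (inj₁ (P⊆∅ , _)) inf = P⊆∅ (proj₁ (proj₂ (inf [])))
AtMostOne⇒¬Infinite (inj₂ (m , P⊆m , _)) inf with n , n∈P , n∉ ← inf [ m ] = n∉ (here (sym (P⊆m n∈P)))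

none-missed : ∀ {P} → (∀ n → P n) → AtMostOne (ℕ⁺ ∖ P)
none-missed all = inj₁ ((λ (_ , n∉P) → n∉P (all _)) , λ ())

one-missed : ∀ {P} m → 0 < m → ¬ P m → (∀ n → n ≢ m → P n) → AtMostOne (ℕ⁺ ∖ P)
one-missed m m>0 m∉P rest = inj₂ (m
  -- `rest` only refutes n ≢ m; decidable equality removes the double negation.
  , (λ {n} (_ , n∉P) → sym (decidable-stable (n ≟ m) (n∉P ∘ rest n)))
  , λ { refl → m>0 , m∉P })

-- The values are closed under adding p + q, so one representative per residue class suffices. The
-- same recursion serves the other pairs.
all-1-1 : ∀ n → Blocks 2 1 1 n
all-1-1 0             = Blocks-zero
all-1-1 1             = 1 , 0 , 0 , s≤s z≤n , refl
all-1-1 (suc (suc n)) = Blocks-+pq (all-1-1 n)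

all-1-2 : ∀ n → Blocks 2 1 2 n
all-1-2 0                   = Blocks-zero
all-1-2 1                   = 1 , 0 , 0 , s≤s z≤n , refl
all-1-2 2                   = 0 , 1 , 0 , s≤s z≤n , refl
all-1-2 (suc (suc (suc n))) = Blocks-+pq (all-1-2 n)

all-1-3 : ∀ n → Blocks 2 1 3 n
all-1-3 0                         = Blocks-zero
all-1-3 1                         = 1 , 0 , 0 , s≤s z≤n , refl
all-1-3 2                         = 2 , 0 , 0 , s≤s (s≤s z≤n) , refl
all-1-3 3                         = 0 , 1 , 0 , s≤s z≤n , refl
all-1-3 (suc (suc (suc (suc n)))) = Blocks-+pq (all-1-3 n)

all-but-3 : ∀ n → n ≢ 3 → Blocks 2 1 4 n
all-but-3 0 _   = Blocks-zero
all-but-3 1 _   = 1 , 0 , 0 , s≤s z≤n , refl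
all-but-3 2 _   = 2 , 0 , 0 , s≤s (s≤s z≤n) , refl
all-but-3 3 3≢3 = contradiction refl 3≢3
all-but-3 4 _   = 0 , 1 , 0 , s≤s z≤n , refl
all-but-3 (suc (suc (suc (suc (suc n))))) _ with n ≟ 3
-- Here the number is 8, and removing a block would lead to the missing 3; instead 8 = 4 + 4.
... | yes refl = 0 , 2 , 0 , s≤s (s≤s z≤n) , refl
... | no n≢3   = Blocks-+pq (all-but-3 n n≢3)

-- A letter of weight 4 or a block of weight 5 is already too heavy, and two letters of weight 1 are
-- too light.
3-missed : ¬ Blocks 2 1 4 3
3-missed (0 , 0     , zero  , _ , ())
3-missed (0 , 0     , suc _ , _ , ())
3-missed (0 , suc _ , _     , _ , ())
3-missed (1 , 0     , zero  , _ , ())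
3-missed (1 , 0     , suc _ , _ , ())
3-missed (1 , suc _ , _     , _ , ())
3-missed (2 , 0     , zero  , _ , ())
3-missed (2 , 0     , suc _ , _ , ())
3-missed (2 , suc _ , _     , _ , ())
3-missed (suc (suc (suc _)) , _ , _ , s≤s (s≤s ()) , _)

all-but-1 : ∀ n → n ≢ 1 → Blocks 2 2 3 n
all-but-1 0 _   = Blocks-zero
all-but-1 1 1≢1 = contradiction refl 1≢1
all-but-1 2 _   = 1 , 0 , 0 , s≤s z≤n , refl
all-but-1 3 _   = 0 , 1 , 0 , s≤s z≤n , refl
all-but-1 4 _   = 2 , 0 , 0 , s≤s (s≤s z≤n) , refl
all-but-1 (suc (suc (suc (suc (suc n))))) _ with n ≟ 1
-- Here the number is 6, one block above the missing 1; instead 6 = 3 + 3.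
... | yes refl = 0 , 2 , 0 , s≤s (s≤s z≤n) , refl
... | no n≢1   = Blocks-+pq (all-but-1 n n≢1)

1-missed : ¬ Blocks 2 2 3 1
1-missed (0     , 0     , zero  , _ , ())
1-missed (0     , 0     , suc _ , _ , ())
1-missed (0     , suc _ , _     , _ , ())
1-missed (suc _ , _     , _     , _ , ())

missed-AtMostOne-≤ : ∀ {p q} → 0 < p → p ≤ q → gcd p q ≡ 1 → p + q < 6 → AtMostOne (ℕ⁺ ∖ Blocks 2 p q)
missed-AtMostOne-≤ {1} {1} _ _ _ _ = none-missed all-1-1
missed-AtMostOne-≤ {1} {2} _ _ _ _ = none-missed all-1-2
missed-AtMostOne-≤ {1} {3} _ _ _ _ = none-missed all-1-3
missed-AtMostOne-≤ {1} {4} _ _ _ _ = one-missed 3 z<s 3-missed all-but-3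
missed-AtMostOne-≤ {2} {1} _ (s≤s ()) _ _
-- The gcd computes to 2, so the coprimality hypothesis is absurd.
missed-AtMostOne-≤ {2} {2} _ _ () _
missed-AtMostOne-≤ {2} {3} _ _ _ _ = one-missed 1 z<s 1-missed all-but-1
missed-AtMostOne-≤ {1} {suc (suc (suc (suc (suc q))))} _ _ _ (s≤s (s≤s (s≤s (s≤s (s≤s (s≤s ()))))))
missed-AtMostOne-≤ {2} {suc (suc (suc (suc q)))} _ _ _ (s≤s (s≤s (s≤s (s≤s (s≤s (s≤s ()))))))
-- If the smaller weight is at least 3, the sum is at least 6.
missed-AtMostOne-≤ {suc (suc (suc p))} {q} _ p≤q _ s<6 =
  contradiction (+-mono-≤ {3} {3 + p} {3} {q} 3≤p (≤-trans 3≤p p≤q)) (<⇒≱ s<6)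
  where
  3≤p : 3 ≤ 3 + p
  3≤p = m≤m+n 3 p

missed-AtMostOne : ∀ {p q} → 0 < p → 0 < q → gcd p q ≡ 1 → p + q < 6 → AtMostOne (ℕ⁺ ∖ Blocks 2 p q)
missed-AtMostOne {p} {q} p>0 q>0 gcd≡1 s<6 with ≤-total p q
... | inj₁ p≤q = missed-AtMostOne-≤ p>0 p≤q gcd≡1 s<6
... | inj₂ q≤p = AtMostOne-resp-≐
  ((λ (n>0 , ∉) → n>0 , ∉ ∘ Blocks-swap) , (λ (n>0 , ∉) → n>0 , ∉ ∘ Blocks-swap))
  (missed-AtMostOne-≤ q>0 q≤p (trans (gcd-comm q p) gcd≡1) (subst (_< 6) (+-comm p q) s<6))

theorem8 : (h : Homomorphism) → let open Homomorphism h in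
    gcd (S (letter a)) (S (letter b)) ≡ 1 →
    (Infinite (ℕ⁺ ∖ Image S) ⇔ S (letter a) + S (letter b) ≥ 6)
    × (S (letter a) + S (letter b) < 6 →
    ((ℕ⁺ ∖ Image S) ≐ ∅) ⊎ (∃ λ m → (ℕ⁺ ∖ Image S) ≐ ｛ m ｝))
-- The forward direction goes by contraposition: a sum below 6 leaves at most one missed value.
theorem8 h gcd≡1 = mk⇔ (λ inf → ≮⇒≥ λ s<6 → AtMostOne⇒¬Infinite (small s<6) inf) large , small
  where
  open Homomorphism h

  small : S (letter a) + S (letter b) < 6 → AtMostOne (ℕ⁺ ∖ Image S)
  small = AtMostOne-resp-≐ (missed≐ h) ∘ missed-AtMostOne (positive _) (positive _) gcd≡1

  large : S (letter a) + S (letter b) ≥ 6 → Infinite (ℕ⁺ ∖ Image S)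
  large s≥6 xs with n , n-missed , n∉xs ← missed-infinite (positive (letter a)) (gcd≡1⇒coprime gcd≡1) s≥6 xs =
    n , proj₂ (missed≐ h) n-missed , n∉xs
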